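{- For every approximation space $(Ob, R)$, let $B^{\ast} = \{(LX, MX) : X \subseteq Ob\}$ be the collection of all its rough sets, equipped with the operations $\wedge, \vee, \sim, \bigtriangledown$ and the constant $1 = (Ob, Ob)$ defined in the context. Then the system $(B^{\ast}, \wedge, \vee, \sim, \bigtriangledown, 1)$ is a three-valued Łukasiewicz algebra.
   Context: An approximation space is a pair $(Ob, R)$ where $Ob$ is a nonempty set and $R$ is an equivalence relation on $Ob$. For $x \in Ob$, $\vert x \vert$ denotes the $R$-equivalence class of $x$, and $R^{\ast}$ is the set of all equivalence classes. For $X \subseteq Ob$ write $\neg X = Ob \setminus X$ and $$MX = \bigcup \{C \in R^{\ast} : C \cap X \neq \emptyset\}, \qquad LX = \neg M \neg X = \bigcup \{C \in R^{\ast} : C \subseteq X\}.$$ A rough set of $(Ob,R)$ is a pair $(LX, MX)$ with $X \subseteq Ob$. Operations on $B^{\ast} = \{(LX,MX) : X \subseteq Ob\}$: $$(LX, MX) \wedge (LY, MY) = (LX \cap LY,\ MX \cap MY),$$ $$(LX, MX) \vee (LY, MY) = (LX \cup LY,\ MX \cup MY),$$ $$\sim (LX, MX) = (L \neg MX,\ M \neg LX) = (L \neg X,\ M \neg X),$$ $$\bigtriangledown (LX, MX) = (LMX,\ MMX) = (MX, MX),$$ $$0 = (\emptyset, \emptyset), \qquad 1 = (Ob, Ob).$$ (It is known that these pairs belong to $B^{\ast}$: the meet is $(LU, MU)$ with $U = MX \cap Y \cap (X \cup M\neg Y)$ and the join is $(LV, MV)$ with $V = LX \cup Y \cup (X \cap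 L \neg Y)$.) A De Morgan algebra $(A, \wedge, \vee, \sim, 1)$ is a distributive lattice $(A, \wedge, \vee)$ with greatest element $1$ and a unary operation $\sim$ satisfying $\sim\sim x = x$ and $\sim(x \wedge y) = \sim x\ \vee \sim y$; its least element is $0 = \sim 1$. A three-valued Łukasiewicz algebra is an algebra $(A, \wedge, \vee, \sim, \bigtriangledown, 1)$ of type $(2,2,1,1,0)$ such that $(A, \wedge, \vee, \sim, 1)$ is a De Morgan algebra and, for all $x, y \in A$: $\sim x \vee \bigtriangledown x = 1$; $x\, \wedge \sim x = \ \sim x \wedge \bigtriangledown x$; $\bigtriangledown(x \wedge y) = \bigtriangledown x \wedge \bigtriangledown y$. -}

module Defs where

open import Algebra.Core using (Op₁; Op₂)
open import Algebra.Definitions using (Congruent₁)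
open import Algebra.Lattice.Structures using (IsDistributiveLattice)
open import Axiom.DoubleNegationElimination using (DoubleNegationElimination; em⇒dne)
open import Axiom.ExcludedMiddle using (ExcludedMiddle)
open import Data.Empty using (⊥-elim)
open import Data.Product using (Σ; ∃; _×_; _,_; proj₁; proj₂)
open import Data.Sum using (inj₁; inj₂)
open import Level using (Level; _⊔_; suc)
open import Relation.Binary.Core using (Rel)
open import Relation.Binary.Definitions using (Maximum)
open import Relation.Binary.Structures using (IsEquivalence)
open import Relation.Nullary using (yes; no)
open import Relation.Unary using (Pred; _∈_; _⊆_; _≐_; _≬_; _∩_; _∪_; ∁; ⋃)
open import Relation.Unary.Polymorphic using (U)
import Relation.Binary.Construct.NaturalOrder.Left as NaturalOrder

-- Algebras are taken over a setoid equality _≈_, so the unary operations carry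
-- a congruence law; the lattice structure already contains those for _∧_, _∨_.

record IsDeMorganAlgebra {a ℓ} {A : Set a} (_≈_ : Rel A ℓ)
         (_∧_ _∨_ : Op₂ A) (∼_ : Op₁ A) (1# : A) : Set (a ⊔ ℓ) where
  field
    isDistributiveLattice : IsDistributiveLattice _≈_ _∨_ _∧_
    1-greatest            : Maximum (NaturalOrder._≤_ _≈_ _∧_) 1#
    ∼-cong                : Congruent₁ _≈_ ∼_
    ∼-involutive          : ∀ x → (∼ (∼ x)) ≈ x
    ∼-∧                   : ∀ x y → (∼ (x ∧ y)) ≈ ((∼ x) ∨ (∼ y))

record IsThreeValuedŁukasiewiczAlgebra {a ℓ} {A : Set a} (_≈_ : Rel A ℓ)
         (_∧_ _∨_ : Op₂ A) (∼_ ▽_ : Op₁ A) (1# : A) : Set (a ⊔ ℓ) where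
  field
    isDeMorganAlgebra : IsDeMorganAlgebra _≈_ _∧_ _∨_ ∼_ 1#
    ▽-cong            : Congruent₁ _≈_ ▽_
    ∼x∨▽x≈1           : ∀ x → ((∼ x) ∨ (▽ x)) ≈ 1#
    x∧∼x≈∼x∧▽x        : ∀ x → (x ∧ (∼ x)) ≈ ((∼ x) ∧ (▽ x))
    ▽-∧               : ∀ x y → (▽ (x ∧ y)) ≈ ((▽ x) ∧ (▽ y))

record ApproximationSpace (a r : Level) : Set (suc (a ⊔ r)) where
  field
    Ob            : Set a
    nonempty      : Ob
    R             : Rel Ob r
    isEquivalence : IsEquivalence R

-- The mathematics is classical: excluded middle is what makes B* closed under
-- the operations below.

module RoughSets {a r} (em : ExcludedMiddle (a ⊔ r)) (S : ApproximationSpace a r) where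

  open ApproximationSpace S public
  open IsEquivalence isEquivalence
    using () renaming (refl to R-refl; sym to R-sym; trans to R-trans)

  Subset : Set (suc (a ⊔ r))
  Subset = Pred Ob (a ⊔ r)

  ∣_∣ : Ob → Pred Ob r
  ∣ x ∣ = R x

  -- R* is the family of the classes ∣ x ∣ indexed by their representatives
  -- x : Ob, so a union over classes is a union over representatives.
  M : Subset → Subset
  M X = ⋃ (Σ Ob λ x → ∣ x ∣ ≬ X) λ (x , _) → ∣ x ∣

  L : Subset → Subset
  L X = ∁ (M (∁ X))

  private
    dne : DoubleNegationElimination (a ⊔ r)
    dne = em⇒dne em

    M⁺ : ∀ {X y z} → R y z → z ∈ X → y ∈ M X
    M⁺ {y = y} Ryz Xz = (y , _ , Ryz , Xz) , R-refl

    M⁻ : ∀ {X y} → y ∈ M X → ∃ λ z → R y z × z ∈ X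
    M⁻ ((_ , z , Rxz , Xz) , Rxy) = z , R-trans (R-sym Rxy) Rxz , Xz

    M-closed : ∀ {X y z} → R y z → y ∈ M X → z ∈ M X
    M-closed Ryz ((x , ne) , Rxy) = (x , ne) , R-trans Rxy Ryz

    L⁺ : ∀ {X y} → (∀ {z} → R y z → z ∈ X) → y ∈ L X
    L⁺ f m = let _ , Ryz , ¬Xz = M⁻ m in ¬Xz (f Ryz)

    L⁻ : ∀ {X y z} → y ∈ L X → R y z → z ∈ X
    L⁻ l Ryz = dne λ ¬Xz → l (M⁺ Ryz ¬Xz)

    L-closed : ∀ {X y z} → R y z → y ∈ L X → z ∈ L X
    L-closed Ryz l m = l (M-closed (R-sym Ryz) m)

  L-union : ∀ X → L X ≐ ⋃ (Σ Ob λ x → ∣ x ∣ ⊆ X) λ (x , _) → ∣ x ∣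
  L-union X = (λ {y} l → (y , L⁻ l) , R-refl)
            , (λ ((_ , C⊆X) , Rxy) → L⁺ λ Ryz → C⊆X (R-trans Rxy Ryz))

  record RoughSet : Set (suc (a ⊔ r)) where
    constructor roughSet
    field
      lower upper : Subset
      isRough     : ∃ λ X → lower ≐ L X × upper ≐ M X

  open RoughSet public

  infix  4 _≈_
  infixr 7 _∧_
  infixr 6 _∨_
  infix  8 ∼_ ▽_

  _≈_ : Rel RoughSet (a ⊔ r)
  x ≈ y = lower x ≐ lower y × upper x ≐ upper y

  private
    ∧-isRough : ∀ X Y → let W = M X ∩ Y ∩ (X ∪ M (∁ Y)) in
                L X ∩ L Y ≐ L W × M X ∩ M Y ≐ M W
    ∧-isRough X Y =
        ( (λ (lx , ly) → L⁺ λ Ryz →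
             M⁺ R-refl (L⁻ lx Ryz) , L⁻ ly Ryz , inj₁ (L⁻ lx Ryz))
        , (λ l → (L⁺ λ Ryz → inX l Ryz (L⁻ l Ryz))
               , (L⁺ λ Ryz → proj₁ (proj₂ (L⁻ l Ryz)))) )
      , ( to
        , (λ m → let _ , Ryz , mx , Yz , _ = M⁻ m in
             M-closed (R-sym Ryz) mx , M⁺ Ryz Yz) )
      where
      W : Subset
      W = M X ∩ Y ∩ (X ∪ M (∁ Y))
      inX : ∀ {y z} → y ∈ L W → R y z → z ∈ W → z ∈ X
      inX l Ryz (_ , _ , inj₁ Xz) = Xz
      inX l Ryz (_ , _ , inj₂ m)  =
        let _ , Rzw , ¬Yw = M⁻ m in
        ⊥-elim (¬Yw (proj₁ (proj₂ (L⁻ l (R-trans Ryz Rzw)))))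
      to : M X ∩ M Y ⊆ M W
      to {y} (mx , my) with em {y ∈ M (∁ Y)}
      ... | yes m = let _ , Ryz , Yz = M⁻ my in
                    M⁺ Ryz (M-closed Ryz mx , Yz , inj₂ (M-closed Ryz m))
      ... | no ¬m = let _ , Ryz , Xz = M⁻ mx in
                    M⁺ Ryz (M-closed Ryz mx , L⁻ ¬m Ryz , inj₁ Xz)

    ∨-isRough : ∀ X Y → let W = L X ∪ Y ∪ (X ∩ L (∁ Y)) in
                L X ∪ L Y ≐ L W × M X ∪ M Y ≐ M W
    ∨-isRough X Y =
        ( (λ { (inj₁ l) → L⁺ λ Ryz → inj₁ (L-closed Ryz l)
             ; (inj₂ l) → L⁺ λ Ryz → inj₂ (inj₁ (L⁻ l Ryz)) })
        , fromL )
      , ( toM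
        , (λ m → let _ , Ryz , Wz = M⁻ m in fromM Ryz Wz) )
      where
      W : Subset
      W = L X ∪ Y ∪ (X ∩ L (∁ Y))
      fromL : L W ⊆ L X ∪ L Y
      fromL {y} l with em {y ∈ L X}
      ... | yes lx = inj₁ lx
      ... | no ¬lx = inj₂ (L⁺ λ Ryz → inY Ryz (L⁻ l Ryz))
        where
        inX : ∀ {z w} → z ∈ L (∁ Y) → R z w → w ∈ W → w ∈ X
        inX lz Rzw (inj₁ lw)              = L⁻ lw R-refl
        inX lz Rzw (inj₂ (inj₁ Yw))       = ⊥-elim (L⁻ lz Rzw Yw)
        inX lz Rzw (inj₂ (inj₂ (Xw , _))) = Xw
        inY : ∀ {z} → R y z → z ∈ W → z ∈ Y
        inY Ryz (inj₁ lz)              = ⊥-elim (¬lx (L-closed (R-sym Ryz) lz))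
        inY Ryz (inj₂ (inj₁ Yz))       = Yz
        inY Ryz (inj₂ (inj₂ (_ , lz))) = ⊥-elim (¬lx (L-closed (R-sym Ryz)
          (L⁺ λ Rzw → inX lz Rzw (L⁻ l (R-trans Ryz Rzw)))))
      toM : M X ∪ M Y ⊆ M W
      toM (inj₂ my) = let _ , Ryz , Yz = M⁻ my in M⁺ Ryz (inj₂ (inj₁ Yz))
      toM {y} (inj₁ mx) with em {y ∈ M Y}
      ... | yes my = toM (inj₂ my)
      ... | no ¬my = let _ , Ryz , Xz = M⁻ mx in
        M⁺ Ryz (inj₂ (inj₂ (Xz , L⁺ λ Rzw Yw → ¬my (M⁺ (R-trans Ryz Rzw) Yw))))
      fromM : ∀ {y z} → R y z → z ∈ W → y ∈ M X ∪ M Y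
      fromM Ryz (inj₁ lz)              = inj₁ (M⁺ Ryz (L⁻ lz R-refl))
      fromM Ryz (inj₂ (inj₁ Yz))       = inj₂ (M⁺ Ryz Yz)
      fromM Ryz (inj₂ (inj₂ (Xz , _))) = inj₁ (M⁺ Ryz Xz)

    ∼-isRough : ∀ X {P Q} → P ≐ L X → Q ≐ M X →
                L (∁ Q) ≐ L (∁ X) × M (∁ P) ≐ M (∁ X)
    ∼-isRough X (P⊆ , ⊆P) (Q⊆ , ⊆Q) =
        ( (λ l → L⁺ λ Ryz Xz → L⁻ l Ryz (⊆Q (M⁺ R-refl Xz)))
        , (λ l → L⁺ λ Ryz Qz →
             let _ , Rzw , Xw = M⁻ (Q⊆ Qz) in L⁻ l (R-trans Ryz Rzw) Xw) )
      , ( (λ m → let _ , Ryz , ¬Pz = M⁻ m in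
             M-closed (R-sym Ryz) (dne λ ¬m → ¬Pz (⊆P ¬m)))
        , (λ m → let _ , Ryz , ¬Xz = M⁻ m in
             M⁺ Ryz λ Pz → ¬Xz (L⁻ (P⊆ Pz) R-refl)) )

    ∩-cong : ∀ {P P′ Q Q′ : Subset} → P ≐ P′ → Q ≐ Q′ → P ∩ Q ≐ P′ ∩ Q′
    ∩-cong (f , f′) (g , g′) = (λ (p , q) → f p , g q) , (λ (p , q) → f′ p , g′ q)

    ∪-cong : ∀ {P P′ Q Q′ : Subset} → P ≐ P′ → Q ≐ Q′ → P ∪ Q ≐ P′ ∪ Q′
    ∪-cong (f , f′) (g , g′) =
        (λ { (inj₁ p) → inj₁ (f p) ; (inj₂ q) → inj₂ (g q) })
      , (λ { (inj₁ p) → inj₁ (f′ p) ; (inj₂ q) → inj₂ (g′ q) })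

    ≐-trans : ∀ {P Q T : Subset} → P ≐ Q → Q ≐ T → P ≐ T
    ≐-trans (f , f′) (g , g′) = (λ p → g (f p)) , (λ t → f′ (g′ t))

  _∧_ : Op₂ RoughSet
  roughSet P Q (X , P≐ , Q≐) ∧ roughSet P′ Q′ (Y , P′≐ , Q′≐) = roughSet
    (P ∩ P′) (Q ∩ Q′)
    (_ , ≐-trans (∩-cong P≐ P′≐) (proj₁ (∧-isRough X Y))
       , ≐-trans (∩-cong Q≐ Q′≐) (proj₂ (∧-isRough X Y)))

  _∨_ : Op₂ RoughSet
  roughSet P Q (X , P≐ , Q≐) ∨ roughSet P′ Q′ (Y , P′≐ , Q′≐) = roughSet
    (P ∪ P′) (Q ∪ Q′)
    (_ , ≐-trans (∪-cong P≐ P′≐) (proj₁ (∨-isRough X Y))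
       , ≐-trans (∪-cong Q≐ Q′≐) (proj₂ (∨-isRough X Y)))

  ∼_ : Op₁ RoughSet
  ∼ roughSet P Q (X , P≐ , Q≐) = roughSet
    (L (∁ Q)) (M (∁ P)) (∁ X , ∼-isRough X P≐ Q≐)

  ▽_ : Op₁ RoughSet
  ▽ roughSet _ Q _ = roughSet
    (L Q) (M Q) (Q , ((λ l → l) , (λ l → l)) , ((λ m → m) , (λ m → m)))

  1# : RoughSet
  1# = roughSet U U
    (U , ((λ _ → L⁺ λ _ → _) , _) , ((λ _ → M⁺ R-refl _) , _))

{-# OPTIONS --safe #-}
-- Lower and upper approximations are unions of R-classes, and M and L fix every
-- such union. For a rough set (P , Q) this gives ∼ (P , Q) = (∁ Q , ∁ P) and
-- ▽ (P , Q) = (Q , Q), with P ⊆ Q, so that the axioms become Boolean identities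
-- between subsets, one for each component.
module Submission where

open import Defs
open import Algebra.Definitions using (Congruent₁)
open import Algebra.Lattice.Structures using (IsDistributiveLattice)
open import Axiom.DoubleNegationElimination using (DoubleNegationElimination; em⇒dne)
open import Axiom.ExcludedMiddle using (ExcludedMiddle)
open import Data.Empty using (⊥-elim)
open import Data.Product using (_,_; proj₁; proj₂)
open import Data.Sum using (inj₁; inj₂; [_,_])
open import Function using (_∘_)
open import Level using (_⊔_)
open import Relation.Binary.Structures using (IsEquivalence)
open import Relation.Nullary using (yes; no)
open import Relation.Unary using (_∈_; _⊆_; _≐_; _∩_; _∪_; ∁)
open import Relation.Unary.Algebra
open import Relation.Unary.Polymorphic using (U)
open import Relation.Unary.Properties using (≐-refl; ≐-sym; ≐-trans)
open import Relation.Unary.Relation.Binary.Equality using (≐-setoid)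
import Relation.Binary.Reasoning.Setoid as ≈-Reasoning

module _ {a r} (em : ExcludedMiddle (a ⊔ r)) (S : ApproximationSpace a r) where

  open RoughSets em S
  open IsEquivalence isEquivalence
    using () renaming (refl to R-refl; sym to R-sym; trans to R-trans)
  open ≈-Reasoning (≐-setoid Ob (a ⊔ r))

  private
    dne : DoubleNegationElimination (a ⊔ r)
    dne = em⇒dne em

    variable
      X Y : Subset

  -- These are exactly the unions of `R`-classes, stated without choosing representatives.
  Closed : Subset → Set (a ⊔ r)
  Closed X = ∀ {y z} → R y z → y ∈ X → z ∈ X

  Closed-resp-≐ : X ≐ Y → Closed X → Closed Y
  Closed-resp-≐ (X⊆Y , Y⊆X) cX Ryz = X⊆Y ∘ cX Ryz ∘ Y⊆X

  -- Symmetry of `R` carries membership in `X` back from `z` to `y`.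
  ∁-closed : Closed X → Closed (∁ X)
  ∁-closed cX Ryz ¬Xy = ¬Xy ∘ cX (R-sym Ryz)

  M-closed : ∀ X → Closed (M X)
  M-closed X Ryz (C , Rxy) = C , R-trans Rxy Ryz

  L-closed : ∀ X → Closed (L X)
  L-closed X = ∁-closed (M-closed (∁ X))

  ⊆M : X ⊆ M X
  ⊆M {x = y} Xy = (y , y , R-refl , Xy) , R-refl

  L⊆ : L X ⊆ X
  L⊆ l = dne (l ∘ ⊆M)

  -- A point `y` of `M X` shares a class with some `z` in `X`, and closedness moves membership from
  -- `z` to `y` through the representative of that class.
  M-fix : Closed X → M X ≐ X
  M-fix cX = (λ ((_ , _ , Rxz , Xz) , Rxy) → cX (R-trans (R-sym Rxz) Rxy) Xz) , ⊆M

  ∁-cong : X ≐ Y → ∁ X ≐ ∁ Y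
  ∁-cong (X⊆Y , Y⊆X) = (_∘ Y⊆X) , (_∘ X⊆Y)

  ∁-involutive : ∀ (X : Subset) → ∁ (∁ X) ≐ X
  ∁-involutive X = dne , λ x ¬x → ¬x x

  ∁-∩ : ∀ (X Y : Subset) → ∁ (X ∩ Y) ≐ ∁ X ∪ ∁ Y
  ∁-∩ X Y = to , [ (λ ¬x → ¬x ∘ proj₁) , (λ ¬y → ¬y ∘ proj₂) ]
    where
    to : ∁ (X ∩ Y) ⊆ ∁ X ∪ ∁ Y
    -- Deciding membership in `X` alone suffices: if it holds, membership in `Y` is refuted.
    to {z} ¬xy with em {z ∈ X}
    ... | yes x = inj₂ λ y → ¬xy (x , y)
    ... | no ¬x = inj₁ ¬x

  ⊆⇒∁∪≐U : X ⊆ Y → ∁ X ∪ Y ≐ U {ℓ = a ⊔ r}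
  ⊆⇒∁∪≐U {X} {Y} X⊆Y = _ , λ {z} _ → cover z
    where
    cover : ∀ z → z ∈ ∁ X ∪ Y
    cover z with em {z ∈ X}
    ... | yes x = inj₂ (X⊆Y x)
    ... | no ¬x = inj₁ ¬x

  -- Both sides are empty.
  ⊆⇒∩∁≐∁∩ : X ⊆ Y → X ∩ ∁ Y ≐ ∁ Y ∩ Y
  ⊆⇒∩∁≐∁∩ X⊆Y = (λ (x , ¬y) → ⊥-elim (¬y (X⊆Y x))) , λ (¬y , y) → ⊥-elim (¬y y)

  L-fix : Closed X → L X ≐ X
  L-fix {X} cX = ≐-trans (∁-cong (M-fix (∁-closed cX))) (∁-involutive X)

  lower-closed : ∀ x → Closed (lower x)
  lower-closed x = let X , P≐ , _ = isRough x in Closed-resp-≐ (≐-sym P≐) (L-closed X)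

  upper-closed : ∀ x → Closed (upper x)
  upper-closed x = let X , _ , Q≐ = isRough x in Closed-resp-≐ (≐-sym Q≐) (M-closed X)

  -- The set `X` approximated by both components links them: `P ⊆ L X ⊆ X ⊆ M X ⊆ Q`.
  lower⊆upper : ∀ x → lower x ⊆ upper x
  lower⊆upper x = let _ , (P⊆ , _) , (_ , ⊆Q) = isRough x in ⊆Q ∘ ⊆M ∘ L⊆ ∘ P⊆

  lower-∼ : ∀ x → lower (∼ x) ≐ ∁ (upper x)
  lower-∼ x = L-fix (∁-closed (upper-closed x))

  upper-∼ : ∀ x → upper (∼ x) ≐ ∁ (lower x)
  upper-∼ x = M-fix (∁-closed (lower-closed x))

  lower-▽ : ∀ x → lower (▽ x) ≐ upper x
  lower-▽ x = L-fix (upper-closed x)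

  upper-▽ : ∀ x → upper (▽ x) ≐ upper x
  upper-▽ x = M-fix (upper-closed x)

  ∼-cong : Congruent₁ _≈_ ∼_
  ∼-cong {x} {y} (P≐ , Q≐) =
      ≐-trans (lower-∼ x) (≐-trans (∁-cong Q≐) (≐-sym (lower-∼ y)))
    , ≐-trans (upper-∼ x) (≐-trans (∁-cong P≐) (≐-sym (upper-∼ y)))

  ▽-cong : Congruent₁ _≈_ ▽_
  ▽-cong {x} {y} (_ , Q≐) =
      ≐-trans (lower-▽ x) (≐-trans Q≐ (≐-sym (lower-▽ y)))
    , ≐-trans (upper-▽ x) (≐-trans Q≐ (≐-sym (upper-▽ y)))

  ∼-involutive : ∀ x → ∼ (∼ x) ≈ x
  ∼-involutive x =
      ≐-trans (lower-∼ (∼ x)) (≐-trans (∁-cong (upper-∼ x)) (∁-involutive (lower x)))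
    , ≐-trans (upper-∼ (∼ x)) (≐-trans (∁-cong (lower-∼ x)) (∁-involutive (upper x)))

  ∼-∧ : ∀ x y → ∼ (x ∧ y) ≈ (∼ x) ∨ (∼ y)
  ∼-∧ x y =
      (begin
        lower (∼ (x ∧ y))            ≈⟨ lower-∼ (x ∧ y) ⟩
        ∁ (upper x ∩ upper y)        ≈⟨ ∁-∩ (upper x) (upper y) ⟩
        ∁ (upper x) ∪ ∁ (upper y)    ≈⟨ ∪-cong (lower-∼ x) (lower-∼ y) ⟨
        lower (∼ x) ∪ lower (∼ y)    ∎)
    , (begin
        upper (∼ (x ∧ y))            ≈⟨ upper-∼ (x ∧ y) ⟩
        ∁ (lower x ∩ lower y)        ≈⟨ ∁-∩ (lower x) (lower y) ⟩
        ∁ (lower x) ∪ ∁ (lower y)    ≈⟨ ∪-cong (upper-∼ x) (upper-∼ y) ⟨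
        upper (∼ x) ∪ upper (∼ y)    ∎)

  -- The lower component is excluded middle for `upper x`. The upper one is `∁ (lower x) ∪ upper x`,
  -- which is everything because `lower x ⊆ upper x`.
  ∼x∨▽x≈1 : ∀ x → (∼ x) ∨ (▽ x) ≈ 1#
  ∼x∨▽x≈1 x =
      ≐-trans (∪-cong (lower-∼ x) (lower-▽ x)) (⊆⇒∁∪≐U λ q → q)
    , ≐-trans (∪-cong (upper-∼ x) (upper-▽ x)) (⊆⇒∁∪≐U (lower⊆upper x))

  -- In the lower component both sides are empty; in the upper one `▽` changes nothing, which leaves
  -- commutativity.
  x∧∼x≈∼x∧▽x : ∀ x → x ∧ (∼ x) ≈ (∼ x) ∧ (▽ x)
  x∧∼x≈∼x∧▽x x =
      (begin
        lower x ∩ lower (∼ x)        ≈⟨ ∩-cong ≐-refl (lower-∼ x) ⟩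
        lower x ∩ ∁ (upper x)        ≈⟨ ⊆⇒∩∁≐∁∩ (lower⊆upper x) ⟩
        ∁ (upper x) ∩ upper x        ≈⟨ ∩-cong (lower-∼ x) (lower-▽ x) ⟨
        lower (∼ x) ∩ lower (▽ x)    ∎)
    , (begin
        upper x ∩ upper (∼ x)        ≈⟨ ∩-comm (upper x) (upper (∼ x)) ⟩
        upper (∼ x) ∩ upper x        ≈⟨ ∩-cong ≐-refl (upper-▽ x) ⟨
        upper (∼ x) ∩ upper (▽ x)    ∎)

  -- `M` does not preserve intersections of arbitrary sets; here the upper components are closed, so
  -- both `L` and `M` fix them and their intersection.
  ▽-∧ : ∀ x y → ▽ (x ∧ y) ≈ (▽ x) ∧ (▽ y)
  ▽-∧ x y =
      ≐-trans (lower-▽ (x ∧ y)) (≐-sym (∩-cong (lower-▽ x) (lower-▽ y)))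
    , ≐-trans (upper-▽ (x ∧ y)) (≐-sym (∩-cong (upper-▽ x) (upper-▽ y)))

  -- Since `∧` and `∨` act as `∩` and `∪` on each component, and `≈` ignores the witness `X`, every
  -- law is inherited from the lattice of subsets.
  isDistributiveLattice : IsDistributiveLattice _≈_ _∨_ _∧_
  isDistributiveLattice = record
    { isLattice = record
      { isEquivalence = record
        { refl  = ≐-refl , ≐-refl
        ; sym   = λ (p , q) → ≐-sym p , ≐-sym q
        ; trans = λ (p , q) (p′ , q′) → ≐-trans p p′ , ≐-trans q q′
        }
      ; ∨-comm     = λ x y → ∪-comm _ _ , ∪-comm _ _
      ; ∨-assoc    = λ x y z → ∪-assoc _ _ _ , ∪-assoc _ _ _
      ; ∨-cong     = λ (p , q) (p′ , q′) → ∪-cong p p′ , ∪-cong q q′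
      ; ∧-comm     = λ x y → ∩-comm _ _ , ∩-comm _ _
      ; ∧-assoc    = λ x y z → ∩-assoc _ _ _ , ∩-assoc _ _ _
      ; ∧-cong     = λ (p , q) (p′ , q′) → ∩-cong p p′ , ∩-cong q q′
      ; absorptive = (λ x y → ∪-abs-∩ _ (lower y) , ∪-abs-∩ _ (upper y))
                   , (λ x y → ∩-abs-∪ _ (lower y) , ∩-abs-∪ _ (upper y))
      }
    ; ∨-distrib-∧ = (λ x y z → ∪-distribˡ-∩ _ _ _ , ∪-distribˡ-∩ _ _ _)
                  , (λ x y z → ∪-distribʳ-∩ _ _ _ , ∪-distribʳ-∩ _ _ _)
    ; ∧-distrib-∨ = (λ x y z → ∩-distribˡ-∪ _ _ _ , ∩-distribˡ-∪ _ _ _)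
                  , (λ x y z → ∩-distribʳ-∪ _ _ _ , ∩-distribʳ-∪ _ _ _)
    }

  isDeMorganAlgebra : IsDeMorganAlgebra _≈_ _∧_ _∨_ ∼_ 1#
  isDeMorganAlgebra = record
    { isDistributiveLattice = isDistributiveLattice
    -- The natural order reads `x ≤ 1#` as `x ≈ x ∧ 1#`, hence the reversed identity law.
    ; 1-greatest            = λ x → ≐-sym (∩-identityʳ (lower x)) , ≐-sym (∩-identityʳ (upper x))
    ; ∼-cong                = λ {x} {y} → ∼-cong {x} {y}
    ; ∼-involutive          = ∼-involutive
    ; ∼-∧                   = ∼-∧
    }

theorem3p1 : ∀ {a r} (em : ExcludedMiddle (a ⊔ r)) (S : ApproximationSpace a r) →
    let open RoughSets em S in
    IsThreeValuedŁukasiewiczAlgebra _≈_ _∧_ _∨_ ∼_ ▽_ 1#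
theorem3p1 em S = record
  { isDeMorganAlgebra = isDeMorganAlgebra em S
  ; ▽-cong            = λ {x} {y} → ▽-cong em S {x} {y}
  ; ∼x∨▽x≈1           = ∼x∨▽x≈1 em S
  ; x∧∼x≈∼x∧▽x        = x∧∼x≈∼x∧▽x em S
  ; ▽-∧               = ▽-∧ em S
  }
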